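{- For all positive integers $n$ and $r$, \[ k(K_{rn}^{(r+1)};r)\leq k(n,r)\leq k(K_{rn}^{(r+1)};r)+5. \]
   Context: For a hypergraph $H=(V,E)$ (all hyperedges of size at least 2) and $r\in\mathbb N$, a colouring of the $r$-subsets of $V$ makes a hyperedge $e$ with $|e|\geq r+1$ monochromatic if all $r$-subsets of $e$ receive the same colour; $k(H;r)$ is the least $k$ for which there is a colouring of the $r$-subsets of $V$ with $k$ colours with no monochromatic hyperedge of size $\geq r+1$. $\chi(H)$ is the vertex chromatic number (least number of colours in a vertex colouring with no monochromatic hyperedge). $k(n,r)=\max\{k(H;r):\chi(H)=n\}$. $K_m^{(r+1)}$ is the complete $(r+1)$-uniform hypergraph on $m$ vertices. -}

module Defs where

open import Level using (Level; 0ℓ)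
open import Data.Nat.Base using (ℕ; suc; _≤_)
open import Data.Nat.Properties using (≤-reflexive; ≤-trans)
open import Data.Fin.Base using (Fin)
open import Data.Fin.Subset using (Subset; _∈_; _⊆_; ∣_∣)
open import Data.Product.Base using (Σ-syntax; ∃-syntax; _×_; proj₁)
open import Relation.Binary.PropositionalEquality using (_≡_; sym)
open import Relation.Nullary using (¬_)
open import Relation.Unary using (Pred)

private
  variable
    ℓ : Level

IsLeast : Pred ℕ ℓ → ℕ → Set ℓ
IsLeast P k = P k × (∀ j → P j → k ≤ j)

IsGreatest : Pred ℕ ℓ → ℕ → Set ℓ
IsGreatest P k = P k × (∀ j → P j → j ≤ k)

-- Finite hypergraphs, with vertex set Fin order.  The edge set is an arbitrary
-- predicate; it is not assumed to be decidable.
record Hypergraph : Set₁ where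
  field
    order  : ℕ
    Edge   : Pred (Subset order) 0ℓ
    edge≥2 : ∀ {e} → Edge e → 2 ≤ ∣ e ∣

open Hypergraph public

completeUniform : (m s : ℕ) → 2 ≤ s → Hypergraph
completeUniform m s 2≤s = record
  { order  = m
  ; Edge   = λ e → ∣ e ∣ ≡ s
  ; edge≥2 = λ ∣e∣≡s → ≤-trans 2≤s (≤-reflexive (sym ∣e∣≡s))
  }

VertexColourable : Hypergraph → ℕ → Set
VertexColourable H k =
  Σ[ f ∈ (Fin (order H) → Fin k) ]
    (∀ e → Edge H e → ¬ (∀ x y → x ∈ e → y ∈ e → f x ≡ f y))

IsChromaticNumber : Hypergraph → ℕ → Set
IsChromaticNumber H = IsLeast (VertexColourable H)

_-SubsetOf_ : ℕ → ℕ → Set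
r -SubsetOf m = Σ[ s ∈ Subset m ] ∣ s ∣ ≡ r

Monochromatic : ∀ {m r k} → (r -SubsetOf m → Fin k) → Subset m → Set
Monochromatic {m} {r} c e =
  (s t : r -SubsetOf m) → proj₁ s ⊆ e → proj₁ t ⊆ e → c s ≡ c t

SetColourable : Hypergraph → ℕ → ℕ → Set
SetColourable H r k =
  Σ[ c ∈ (r -SubsetOf order H → Fin k) ]
    (∀ e → Edge H e → suc r ≤ ∣ e ∣ → ¬ Monochromatic c e)

-- Is-k[ H ⨾ r ] k  says that  k(H; r) = k.
Is-k[_⨾_] : Hypergraph → ℕ → ℕ → Set
Is-k[ H ⨾ r ] = IsLeast (SetColourable H r)

-- Is-k⟨ n , r ⟩ k  says that the maximum  k(n, r)  exists and equals k.
Is-k⟨_,_⟩ : ℕ → ℕ → ℕ → Set₁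
Is-k⟨ n , r ⟩ =
  IsGreatest (λ k → ∃[ H ] (IsChromaticNumber H n × Is-k[ H ⨾ r ] k))

{-# OPTIONS --safe #-}

-- Call a colouring of the words of length r over Fin n good if no non-constant word of length r + 1 has
-- all its subwords of length r of the same colour.  A good colouring with k colours yields k(H; r) ≤ k for
-- every n-colourable H: colour a set by the word of the colours of its vertices.  Conversely, by Ramsey's
-- theorem, a colouring of the r-subsets of a large enough hypergraph with n classes yields a good word
-- colouring, so k(n, r) is the least number of colours of a good word colouring.  This gives the lower
-- bound, since K_{rn} is n-colourable.  For the upper bound, colour the words without repeated letters by
-- an optimal colouring of K_n ⊆ K_{rn} applied to their sets of letters, and the words with repetitions by
-- the parities of the number of distinct letters and of the number of occurrences of the first letter;
-- thus 4 additional colours suffice.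
module Submission where

open import Defs
open import Data.Nat.Base using
  (ℕ; zero; suc; _+_; _*_; _≤_; _<_; z≤n; s≤s; s≤s⁻¹; _≤′_; ≤′-reflexive; ≤′-step; NonZero; >-nonZero⁻¹)
open import Data.Nat.Induction using (<-wellFounded; Acc; acc)
open import Data.Nat.Properties as ℕ using (≤-reflexive; ≤-trans)
open import Data.Fin.Base using (Fin; zero; suc; join; splitAt; combine; inject≤; quotient; remainder)
  renaming (_<_ to _<ᶠ_)
open import Data.Fin.Properties as Fin
  using (splitAt-join; combine-injective; remQuot-combine; combine-remQuot; inject≤-injective)
open import Data.Fin.Subset using (Subset; inside; outside; _∈_; _∉_; _⊆_; ∣_∣; ⊥; ⊤; ⁅_⁆; _∪_; _∩_; ∁)
open import Data.Fin.Subset.Properties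
open import Data.List.Base using (List; []; _∷_; length; filter; take; allFin; zipWith; map; cartesianProductWith)
open import Data.List.Properties
  using (filter-accept; filter-reject; filter-none; filter-some; length-take; length-tabulate; length-map)
open import Data.List.Membership.Propositional using () renaming (_∈_ to _∈ˡ_; _∉_ to _∉ˡ_)
open import Data.List.Membership.Propositional.Properties
  using (∈-filter⁺; ∈-filter⁻; ∈-map⁻; ∈-allFin; ∈-cartesianProductWith⁺)
open import Data.List.Relation.Binary.Sublist.Propositional using ([]; _∷_; _∷ʳ_; minimum)
  renaming (_⊆_ to _≼_; ⊆-refl to ≼-refl; ⊆-trans to ≼-trans)
open import Data.List.Relation.Binary.Sublist.Propositional.Properties using (filter-⊆; take-⊆; All-resp-⊆)
open import Data.List.Relation.Unary.All using (All; []; _∷_)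
open import Data.List.Relation.Unary.All.Properties using (¬Any⇒All¬)
open import Data.List.Relation.Unary.AllPairs using ([]; _∷_)
open import Data.List.Relation.Unary.Any using (here; there; any?)
open import Data.List.Relation.Unary.Unique.Propositional using (Unique)
import Data.List.Relation.Unary.Unique.Propositional.Properties as Unique
open import Data.Product.Base using (Σ-syntax; ∃; ∃-syntax; ∃₂; _×_; _,_; proj₁; proj₂)
open import Data.Sum.Base using (_⊎_; inj₁; inj₂)
open import Data.Sum.Properties using (inj₁-injective; inj₂-injective)
open import Data.Vec.Base as Vec using (Vec; []; _∷_; here; there; _[_]%=_)
import Data.Vec.Properties as Vec
open import Function.Base using (_∘_; id)
open import Relation.Binary.PropositionalEquality
  using (_≡_; _≢_; refl; sym; trans; cong; cong₂; subst; ≢-sym; module ≡-Reasoning)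
open import Relation.Nullary using (¬_; Dec; yes; no; contradiction)
open import Relation.Nullary.Decidable using (map′; decidable-stable; ¬?; _→-dec_)
open import Relation.Unary using (Decidable)

private
  variable
    A B : Set
    m n k q r : ℕ

-- Words

-- Sublists `≼` need not be contiguous. `A` is arbitrary so that the same notion serves words over
-- the colour classes and, in Ramsey's theorem, lists of points.
Homogeneous : ℕ → (List A → B) → List A → Set
Homogeneous r κ xs =
  ∀ v w → v ≼ xs → w ≼ xs → length v ≡ r → length w ≡ r → κ v ≡ κ w

WordColourable : ℕ → ℕ → ℕ → Set
WordColourable n r k =
  Σ[ d ∈ (List (Fin n) → Fin k) ]
    (∀ t {x y} → length t ≡ suc r → x ∈ˡ t → y ∈ˡ t → x ≢ y → ¬ Homogeneous r d t)

support : List (Fin n) → Subset n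
support []      = ⊥
support (x ∷ w) = ⁅ x ⁆ ∪ support w

∈-support⁺ : ∀ {x : Fin n} {w} → x ∈ˡ w → x ∈ support w
∈-support⁺ {w = y ∷ w} (here refl) = p⊆p∪q (support w) (x∈⁅x⁆ y)
∈-support⁺ {w = y ∷ w} (there x∈w) = q⊆p∪q ⁅ y ⁆ (support w) (∈-support⁺ x∈w)

∈-support⁻ : ∀ {x : Fin n} w → x ∈ support w → x ∈ˡ w
∈-support⁻ []      x∈ = contradiction x∈ ∉⊥
∈-support⁻ (y ∷ w) x∈ with x∈p∪q⁻ ⁅ y ⁆ (support w) x∈
... | inj₁ x∈⁅y⁆ = here (x∈⁅y⁆⇒x≡y y x∈⁅y⁆)
... | inj₂ x∈w   = there (∈-support⁻ w x∈w)

x∈p⇒⁅x⁆∪p≡p : ∀ {x} {p : Subset n} → x ∈ p → ⁅ x ⁆ ∪ p ≡ p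
x∈p⇒⁅x⁆∪p≡p {x = x} {p} x∈p = ⊆-antisym ⊆p (q⊆p∪q ⁅ x ⁆ p)
  where
  ⊆p : ⁅ x ⁆ ∪ p ⊆ p
  ⊆p y∈ with x∈p∪q⁻ ⁅ x ⁆ p y∈
  ... | inj₁ y∈⁅x⁆ = subst (_∈ p) (sym (x∈⁅y⁆⇒x≡y x y∈⁅x⁆)) x∈p
  ... | inj₂ y∈p   = y∈p

x∉p⇒∣⁅x⁆∪p∣≡1+∣p∣ : ∀ (x : Fin n) p → x ∉ p → ∣ ⁅ x ⁆ ∪ p ∣ ≡ suc ∣ p ∣
x∉p⇒∣⁅x⁆∪p∣≡1+∣p∣ zero    (inside  ∷ p) x∉p = contradiction here x∉p
x∉p⇒∣⁅x⁆∪p∣≡1+∣p∣ zero    (outside ∷ p) x∉p = cong (suc ∘ ∣_∣) (∪-identityˡ p)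
x∉p⇒∣⁅x⁆∪p∣≡1+∣p∣ (suc x) (inside  ∷ p) x∉p = cong suc (x∉p⇒∣⁅x⁆∪p∣≡1+∣p∣ x p (x∉p ∘ there))
x∉p⇒∣⁅x⁆∪p∣≡1+∣p∣ (suc x) (outside ∷ p) x∉p = x∉p⇒∣⁅x⁆∪p∣≡1+∣p∣ x p (x∉p ∘ there)

∣support∣-∈ : ∀ {x : Fin n} {w} → x ∈ˡ w → ∣ support (x ∷ w) ∣ ≡ ∣ support w ∣
∣support∣-∈ x∈w = cong ∣_∣ (x∈p⇒⁅x⁆∪p≡p (∈-support⁺ x∈w))

∣support∣-∉ : ∀ {x : Fin n} {w} → x ∉ˡ w → ∣ support (x ∷ w) ∣ ≡ suc ∣ support w ∣
∣support∣-∉ {x = x} {w} x∉w =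
  x∉p⇒∣⁅x⁆∪p∣≡1+∣p∣ x (support w) (x∉w ∘ ∈-support⁻ w)

_∈ˡ?_ : (x : Fin n) (w : List (Fin n)) → Dec (x ∈ˡ w)
x ∈ˡ? w = any? (x Fin.≟_) w

∣support∣≤length : ∀ (w : List (Fin n)) → ∣ support w ∣ ≤ length w
∣support∣≤length {n} []      = ≤-reflexive (∣⊥∣≡0 n)
∣support∣≤length     (x ∷ w) with x ∈ˡ? w
... | yes x∈w = ≤-trans (≤-reflexive (∣support∣-∈ x∈w)) (ℕ.m≤n⇒m≤1+n (∣support∣≤length w))
... | no  x∉w = ≤-trans (≤-reflexive (∣support∣-∉ x∉w)) (s≤s (∣support∣≤length w))

∣support∣≡length⇒Unique : ∀ (w : List (Fin n)) → ∣ support w ∣ ≡ length w → Unique w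
∣support∣≡length⇒Unique []      eq = []
∣support∣≡length⇒Unique (x ∷ w) eq with x ∈ˡ? w
... | yes x∈w = contradiction
  (≤-trans (≤-reflexive (trans (sym eq) (∣support∣-∈ x∈w))) (∣support∣≤length w)) (ℕ.<-irrefl refl)
... | no  x∉w = ¬Any⇒All¬ w x∉w ∷
  ∣support∣≡length⇒Unique w (ℕ.suc-injective (trans (sym (∣support∣-∉ x∉w)) eq))

Unique⇒∣support∣≡length : ∀ {w : List (Fin n)} → Unique w → ∣ support w ∣ ≡ length w
Unique⇒∣support∣≡length {n} []        = ∣⊥∣≡0 n
Unique⇒∣support∣≡length u@(_ ∷ u′) =
  trans (∣support∣-∉ (Unique.Unique[x∷xs]⇒x∉xs u)) (cong suc (Unique⇒∣support∣≡length u′))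

-- Filtering `t` by `s` keeps exactly one position for each element of `s`, because `t` has no
-- repetition. This turns the `r`-subsets of a support into subwords of length `r`.
sublist-with-support : ∀ {t : List (Fin n)} → Unique t → ∀ s → s ⊆ support t →
                       ∃[ w ] w ≼ t × support w ≡ s × length w ≡ ∣ s ∣
sublist-with-support {t = t} unique s s⊆t =
  w , filter-⊆ (_∈? s) t , eq ,
  trans (sym (Unique⇒∣support∣≡length (Unique.filter⁺ (_∈? s) unique))) (cong ∣_∣ eq)
  where
  w = filter (_∈? s) t
  eq : support w ≡ s
  eq = ⊆-antisym
    (λ x∈ → proj₂ (∈-filter⁻ (_∈? s) {xs = t} (∈-support⁻ w x∈)))
    (λ x∈s → ∈-support⁺ (∈-filter⁺ (_∈? s) (∈-support⁻ t (s⊆t x∈s)) x∈s))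

-- Deleting one occurrence of a letter

data Delete {A : Set} (x : A) : List A → List A → Set where
  here  : ∀ {w} → Delete x (x ∷ w) w
  there : ∀ {y t w} → Delete x t w → Delete x (y ∷ t) (y ∷ w)

∈⇒Delete : ∀ {x : A} {t} → x ∈ˡ t → ∃ (Delete x t)
∈⇒Delete (here refl) = _ , here
∈⇒Delete (there x∈t) with _ , del ← ∈⇒Delete x∈t = _ , there del

Delete⇒∈ : ∀ {x : A} {t w} → Delete x t w → x ∈ˡ t
Delete⇒∈ here        = here refl
Delete⇒∈ (there del) = there (Delete⇒∈ del)

Delete⇒≼ : ∀ {x : A} {t w} → Delete x t w → w ≼ t
Delete⇒≼ {x = x} here = x ∷ʳ ≼-refl
Delete⇒≼ (there del)  = refl ∷ Delete⇒≼ del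

Delete-length : ∀ {x : A} {t w} → Delete x t w → length t ≡ suc (length w)
Delete-length here        = refl
Delete-length (there del) = cong suc (Delete-length del)

Delete-∈ : ∀ {x y : A} {t w} → Delete x t w → y ≢ x → y ∈ˡ t → y ∈ˡ w
Delete-∈ here        y≢x (here y≡x)  = contradiction y≡x y≢x
Delete-∈ here        y≢x (there y∈t) = y∈t
Delete-∈ (there del) y≢x (here y≡z)  = here y≡z
Delete-∈ (there del) y≢x (there y∈t) = there (Delete-∈ del y≢x y∈t)

Delete-support : ∀ {x : Fin n} {t w} → Delete x t w → support t ≡ support (x ∷ w)
Delete-support here = refl
Delete-support {x = x} (there {y} {t} {w} del) = begin
  ⁅ y ⁆ ∪ support t            ≡⟨ cong (⁅ y ⁆ ∪_) (Delete-support del) ⟩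
  ⁅ y ⁆ ∪ (⁅ x ⁆ ∪ support w)  ≡⟨ ∪-assoc ⁅ y ⁆ ⁅ x ⁆ (support w) ⟨
  (⁅ y ⁆ ∪ ⁅ x ⁆) ∪ support w  ≡⟨ cong (_∪ support w) (∪-comm ⁅ y ⁆ ⁅ x ⁆) ⟩
  (⁅ x ⁆ ∪ ⁅ y ⁆) ∪ support w  ≡⟨ ∪-assoc ⁅ x ⁆ ⁅ y ⁆ (support w) ⟩
  ⁅ x ⁆ ∪ (⁅ y ⁆ ∪ support w)  ∎
  where open ≡-Reasoning

count : Fin n → List (Fin n) → ℕ
count x w = length (filter (x Fin.≟_) w)

count-≡ : ∀ (x : Fin n) w → count x (x ∷ w) ≡ suc (count x w)
count-≡ x w = cong length (filter-accept (x Fin.≟_) refl)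

count-≢ : ∀ {x y : Fin n} w → x ≢ y → count x (y ∷ w) ≡ count x w
count-≢ {x = x} w x≢y = cong length (filter-reject (x Fin.≟_) x≢y)

∈⇒count≢0 : ∀ {x : Fin n} {w} → x ∈ˡ w → count x w ≢ 0
∈⇒count≢0 {x = x} x∈w eq = ℕ.<⇒≢ (filter-some (x Fin.≟_) x∈w) (sym eq)

∉⇒count≡0 : ∀ {x : Fin n} {w} → x ∉ˡ w → count x w ≡ 0
∉⇒count≡0 {x = x} {w} x∉w = cong length (filter-none (x Fin.≟_) (¬Any⇒All¬ w x∉w))

Delete-count : ∀ {x y : Fin n} {t w} → Delete x t w → count y t ≡ count y (x ∷ w)
Delete-count here = refl
Delete-count {x = x} {y} (there {z} del) with y Fin.≟ x | Delete-count {y = y} del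
... | yes _ | ih with y Fin.≟ z
...   | yes _ = cong suc ih
...   | no  _ = ih
Delete-count {x = x} {y} (there {z} del) | no  _ | ih with y Fin.≟ z
...   | yes _ = cong suc ih
...   | no  _ = ih

count≢1⇒∈ : ∀ {x : Fin n} {t w} → Delete x t w → count x t ≢ 1 → x ∈ˡ w
count≢1⇒∈ {x = x} {w = w} del ≢1 with x ∈ˡ? w
... | yes x∈w = x∈w
... | no  x∉w = contradiction
  (trans (Delete-count {y = x} del) (trans (count-≡ x w) (cong suc (∉⇒count≡0 x∉w)))) ≢1

-- The deleted position is the first one whose letter occurs again later, so the support survives
-- the deletion.
repeated-letter : ∀ (t : List (Fin n)) → ∣ support t ∣ ≢ length t →
                  ∃₂ λ y w → Delete y t w × y ∈ˡ w
repeated-letter {n} [] neq = contradiction (∣⊥∣≡0 n) neq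
repeated-letter (x ∷ t) neq with x ∈ˡ? t
... | yes x∈t = x , t , here , x∈t
... | no  x∉t with y , w , del , y∈w ← repeated-letter t
                    (neq ∘ trans (∣support∣-∉ x∉t) ∘ cong suc) =
  y , x ∷ w , there del , there y∈w

-- A word colouring with four additional colours

parity : ℕ → Fin 2
parity zero          = zero
parity (suc zero)    = suc zero
parity (suc (suc n)) = parity n

parity-suc : ∀ n → parity (suc n) ≢ parity n
parity-suc zero          ()
parity-suc (suc zero)    ()
parity-suc (suc (suc n)) = parity-suc n

headCount : List (Fin n) → ℕ
headCount []      = 0
headCount (x ∷ w) = count x w

repeatColour : List (Fin n) → Fin 4
repeatColour w = combine (parity ∣ support w ∣) (parity (headCount w))

-- Among words of length `r`, those with `r` distinct letters are exactly the ones without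
-- repetition. The sum type keeps the palettes of the two kinds of words disjoint.
wordColour : (r -SubsetOf n → Fin k) → List (Fin n) → Fin k ⊎ Fin 4
wordColour {r} c w with ∣ support w ∣ ℕ.≟ r
... | yes eq = inj₁ (c (support w , eq))
... | no  _  = inj₂ (repeatColour w)

module _ (c : r -SubsetOf n → Fin k) where

  wordColour-≡ : ∀ w (eq : ∣ support w ∣ ≡ r) → wordColour c w ≡ inj₁ (c (support w , eq))
  wordColour-≡ w eq with ∣ support w ∣ ℕ.≟ r
  ... | yes eq′ = cong (λ e → inj₁ (c (support w , e))) (ℕ.≡-irrelevant eq′ eq)
  ... | no  neq = contradiction eq neq

  wordColour-≢ : ∀ w → ∣ support w ∣ ≢ r → wordColour c w ≡ inj₂ (repeatColour w)
  wordColour-≢ w neq with ∣ support w ∣ ℕ.≟ r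
  ... | yes eq = contradiction eq neq
  ... | no  _  = refl

  -- A colour of the second palette is shared only by words of that palette, and `combine` is
  -- injective, so both parities can be read off.
  wordColour-repeat : ∀ {v w} → ∣ support v ∣ ≢ r → wordColour c v ≡ wordColour c w →
                      parity ∣ support v ∣ ≡ parity ∣ support w ∣ ×
                      parity (headCount v) ≡ parity (headCount w)
  wordColour-repeat {v} {w} v≢ eq with ∣ support w ∣ ℕ.≟ r | trans (sym (wordColour-≢ v v≢)) eq
  ... | yes _  | ()
  ... | no  w≢ | eq′ = combine-injective _ (parity (headCount v)) _ _ (inj₂-injective eq′)

  module _ (t : List (Fin n)) (∣t∣ : length t ≡ suc r) (hom : Homogeneous r (wordColour c) t) where

    private
      deletions : ∀ {x y v w} → Delete x t v → Delete y t w → wordColour c v ≡ wordColour c w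
      deletions d e = hom _ _ (Delete⇒≼ d) (Delete⇒≼ e)
        (ℕ.suc-injective (trans (sym (Delete-length d)) ∣t∣))
        (ℕ.suc-injective (trans (sym (Delete-length e)) ∣t∣))

    distinct-monochromatic : ∣ support t ∣ ≡ suc r → Monochromatic c (support t)
    distinct-monochromatic eq s s′ s⊆ s′⊆
      with unique ← ∣support∣≡length⇒Unique t (trans eq (sym ∣t∣))
      with w  , w≼  , refl , len  ← sublist-with-support unique (proj₁ s)  s⊆
         | w′ , w′≼ , refl , len′ ← sublist-with-support unique (proj₁ s′) s′⊆
      = inj₁-injective (begin
          inj₁ (c s)      ≡⟨ wordColour-≡ w (proj₂ s) ⟨
          wordColour c w  ≡⟨ hom w w′ w≼ w′≼ (trans len (proj₂ s)) (trans len′ (proj₂ s′)) ⟩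
          wordColour c w′ ≡⟨ wordColour-≡ w′ (proj₂ s′) ⟩
          inj₁ (c s′)     ∎)
      where open ≡-Reasoning

    -- Deleting a letter that occurs once changes the parity of the support, deleting a repeated one does not.
    some-single-impossible : ∣ support t ∣ ≢ suc r → ∀ {z} → z ∈ˡ t → ¬ (count z t ≡ 1)
    some-single-impossible ∣supp∣≢ {z} z∈t once
      with v , del-z ← ∈⇒Delete z∈t
         | y , w , del-y , y∈w ← repeated-letter t (λ eq → ∣supp∣≢ (trans eq ∣t∣))
      = parity-suc ∣ support v ∣ (begin
          parity (suc ∣ support v ∣) ≡⟨ cong parity ∣t∣≡1+∣v∣ ⟨
          parity ∣ support t ∣       ≡⟨ cong (parity ∘ ∣_∣) (Delete-support del-y) ⟩
          parity ∣ support (y ∷ w) ∣ ≡⟨ cong parity (∣support∣-∈ y∈w) ⟩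
          parity ∣ support w ∣       ≡⟨ proj₁ (wordColour-repeat ∣v∣≢r (deletions del-z del-y)) ⟨
          parity ∣ support v ∣       ∎)
      where
      open ≡-Reasoning
      z∉v : z ∉ˡ v
      z∉v z∈v = ∈⇒count≢0 z∈v (ℕ.suc-injective (trans (sym (trans (Delete-count del-z) (count-≡ z v))) once))
      ∣t∣≡1+∣v∣ : ∣ support t ∣ ≡ suc ∣ support v ∣
      ∣t∣≡1+∣v∣ = trans (cong ∣_∣ (Delete-support del-z)) (∣support∣-∉ z∉v)
      ∣v∣≢r : ∣ support v ∣ ≢ r
      ∣v∣≢r eq = ∣supp∣≢ (trans ∣t∣≡1+∣v∣ (cong suc eq))

  -- Deleting a later copy of the first letter changes the parity of its number of occurrences, deleting
  -- another letter does not.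
  no-single-impossible : ∀ {x u} → length (x ∷ u) ≡ suc r → Homogeneous r (wordColour c) (x ∷ u) →
                         (∀ {z} → z ∈ˡ x ∷ u → count z (x ∷ u) ≢ 1) →
                         ¬ (∃[ y ] y ∈ˡ u × x ≢ y)
  no-single-impossible {x} {u} len hom not-once (y , y∈u , x≢y)
    with u₁ , del-x ← ∈⇒Delete {x = x} (count≢1⇒∈ here (not-once (here refl)))
       | u₂ , del-y ← ∈⇒Delete y∈u
    = parity-suc (count x u₁) (trans (cong parity (begin-equality
        suc (count x u₁) ≡⟨ count-≡ x u₁ ⟨
        count x (x ∷ u₁) ≡⟨ Delete-count {y = x} del-x ⟨
        count x u        ≡⟨ Delete-count {y = x} del-y ⟩
        count x (y ∷ u₂) ≡⟨ count-≢ u₂ x≢y ⟩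
        count x u₂       ∎)) (sym (proj₂ (wordColour-repeat ∣w₁∣≢r same))))
    where
    open ℕ.≤-Reasoning
    repeated : ∀ {z w} → Delete z (x ∷ u) w → z ∈ˡ w
    repeated del = count≢1⇒∈ del (not-once (Delete⇒∈ del))
    x∈u₂ : x ∈ˡ u₂
    x∈u₂ = Delete-∈ del-y x≢y (repeated here)
    lengths : ∀ {z w} → Delete z u w → length (x ∷ w) ≡ r
    lengths del = trans (sym (Delete-length del)) (ℕ.suc-injective len)
    same : wordColour c (x ∷ u₁) ≡ wordColour c (x ∷ u₂)
    same = hom _ _ (refl ∷ Delete⇒≼ del-x) (refl ∷ Delete⇒≼ del-y) (lengths del-x) (lengths del-y)
    -- Deleting repeated letters keeps the support, so `x ∷ u₁` has at most as many distinct letters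
    -- as `u₂`, whose length is `r - 1`. Hence `x ∷ u₁` has the colour of a word with repetitions,
    -- and the parities can be compared.
    ∣w₁∣≤∣w₂∣ : ∣ support (x ∷ u₁) ∣ ≤ ∣ support u₂ ∣
    ∣w₁∣≤∣w₂∣ = begin
      ∣ support (x ∷ u₁) ∣       ≤⟨ ∣q∣≤∣p∪q∣ ⁅ x ⁆ (support (x ∷ u₁)) ⟩
      ∣ support (x ∷ x ∷ u₁) ∣   ≡⟨ cong ∣_∣ (Delete-support (there del-x)) ⟨
      ∣ support (x ∷ u) ∣        ≡⟨ cong ∣_∣ (Delete-support (there del-y)) ⟩
      ∣ support (y ∷ x ∷ u₂) ∣   ≡⟨ ∣support∣-∈ (repeated (there del-y)) ⟩
      ∣ support (x ∷ u₂) ∣       ≡⟨ ∣support∣-∈ x∈u₂ ⟩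
      ∣ support u₂ ∣             ∎
    ∣w₁∣≢r : ∣ support (x ∷ u₁) ∣ ≢ r
    ∣w₁∣≢r = ℕ.<⇒≢ (≤-trans (s≤s (≤-trans ∣w₁∣≤∣w₂∣ (∣support∣≤length u₂))) (≤-reflexive (lengths del-y)))

  -- If `t` has `r + 1` distinct letters, its support would be a monochromatic edge for `c`.
  -- Otherwise letters occurring exactly once are ruled out first, which is what
  -- `no-single-impossible` needs to exclude a letter different from the first one.
  wordColour-proper : (∀ e → ∣ e ∣ ≡ suc r → ¬ Monochromatic c e) →
                      ∀ t {x y} → length t ≡ suc r → x ∈ˡ t → y ∈ˡ t → x ≢ y →
                      ¬ Homogeneous r (wordColour c) t
  wordColour-proper proper t@(z ∷ u) {x} {y} len x∈t y∈t x≢y hom with ∣ support t ∣ ℕ.≟ suc r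
  ... | yes eq = proper (support t) eq (distinct-monochromatic t len hom eq)
  ... | no  neq = no-single-impossible len hom (some-single-impossible t len hom neq) other
    where
    tail : ∀ {v} → v ∈ˡ t → z ≢ v → v ∈ˡ u
    tail (here v≡z)  z≢v = contradiction (sym v≡z) z≢v
    tail (there v∈u) z≢v = v∈u
    other : ∃[ v ] v ∈ˡ u × z ≢ v
    other with z Fin.≟ x
    ... | yes refl = y , tail y∈t x≢y , x≢y
    ... | no  z≢x  = x , tail x∈t z≢x , z≢x

join-injective : ∀ m n {x y : Fin m ⊎ Fin n} → join m n x ≡ join m n y → x ≡ y
join-injective m n {x} {y} eq =
  trans (sym (splitAt-join m n x)) (trans (cong (splitAt m) eq) (splitAt-join m n y))

setColourable⇒wordColourable : ∀ {2≤} → SetColourable (completeUniform n (suc r) 2≤) r k →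
                               WordColourable n r (k + 4)
setColourable⇒wordColourable {k = k} (c , proper) =
  join k 4 ∘ wordColour c , λ t len x∈t y∈t x≢y hom →
  wordColour-proper c (λ e ∣e∣ → proper e ∣e∣ (≤-reflexive (sym ∣e∣))) t len x∈t y∈t x≢y
    (λ v w v≼ w≼ ∣v∣ ∣w∣ → join-injective k 4 (hom v w v≼ w≼ ∣v∣ ∣w∣))

-- Induction along `≤′` drops one vertex at a time. With that vertex `outside`, a set keeps its size
-- definitionally, and no set containing the vertex is a subset of such an edge.
restrict : ∀ {2≤} → n ≤′ m → SetColourable (completeUniform m (suc r) 2≤) r k →
           SetColourable (completeUniform n (suc r) 2≤) r k
restrict (≤′-reflexive refl) col = col
restrict {2≤ = 2≤} (≤′-step n≤m) (c , proper) =
  restrict {2≤ = 2≤} n≤m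
    ( (λ (s , ∣s∣) → c (outside ∷ s , ∣s∣))
    , λ e ∣e∣ r<∣e∣ mono → proper (outside ∷ e) ∣e∣ r<∣e∣
        λ { (inside  ∷ s , ∣s∣) _ s⊆ _ → contradiction (s⊆ here) λ ()
          ; (outside ∷ s , ∣s∣) (inside  ∷ t , ∣t∣) _ t⊆ → contradiction (t⊆ here) λ ()
          ; (outside ∷ s , ∣s∣) (outside ∷ t , ∣t∣) s⊆ t⊆ →
              mono (s , ∣s∣) (t , ∣t∣) (drop-∷-⊆ s⊆) (drop-∷-⊆ t⊆) })

-- Ramsey's theorem

Homogeneous-≼ : ∀ {κ : List A → B} {xs ys} → xs ≼ ys → Homogeneous r κ ys → Homogeneous r κ xs
Homogeneous-≼ xs≼ys hom v w v≼ w≼ = hom v w (≼-trans v≼ xs≼ys) (≼-trans w≼ xs≼ys)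

HeadColour : ℕ → (List A → B) → B → A → List A → Set
HeadColour r κ b x xs = ∀ w → w ≼ xs → length w ≡ r → κ (x ∷ w) ≡ b

-- The intermediate stage of the Ramsey induction: the colour of a sublist of length `r + 1` depends
-- only on the position of its first entry. The colour `b` may change from position to position,
-- whereas `HeadConstant` fixes it.
data HeadColoured {A B : Set} (r : ℕ) (κ : List A → B) : List A → Set where
  []   : HeadColoured r κ []
  cons : ∀ {x xs} b → HeadColour r κ b x xs → HeadColoured r κ xs → HeadColoured r κ (x ∷ xs)

data HeadConstant {A B : Set} (r : ℕ) (κ : List A → B) (b : B) : List A → Set where
  []   : HeadConstant r κ b []
  cons : ∀ {x xs} → HeadColour r κ b x xs → HeadConstant r κ b xs → HeadConstant r κ b (x ∷ xs)

HeadConstant⇒colour : ∀ {κ : List A → B} {b xs} → HeadConstant r κ b xs →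
                      ∀ w → w ≼ xs → length w ≡ suc r → κ w ≡ b
HeadConstant⇒colour (cons _  hc) w       (_ ∷ʳ w≼)   len = HeadConstant⇒colour hc w w≼ len
HeadConstant⇒colour (cons hd _)  (_ ∷ w) (refl ∷ w≼) len = hd w w≼ (ℕ.suc-injective len)

sum-decrement : ∀ (f : Vec ℕ q) i {m} → Vec.lookup f i ≡ suc m →
                Vec.sum f ≡ suc (Vec.sum (f [ i ]%= λ _ → m))
sum-decrement (_ ∷ f) zero    refl = refl
sum-decrement (a ∷ f) (suc i) eq   = trans (cong (a +_) (sum-decrement f i eq)) (ℕ.+-suc a _)

-- `target` lists the demand for heads of each colour. Each head lowers the demand for its own
-- colour; a demand of zero is met by the empty list, to which the earlier heads of that colour are
-- added back. The argument of type `Fin q` excludes `q = 0`.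
pigeonhole : ∀ {κ : List A → Fin q} (target : Vec ℕ q) → Fin q → ∀ {xs} → HeadColoured r κ xs →
             Vec.sum target ≤ length xs →
             ∃₂ λ b ys → ys ≼ xs × HeadConstant r κ b ys × length ys ≡ Vec.lookup target b
pigeonhole (zero  ∷ f) _ {xs} _ _ = zero , [] , minimum xs , [] , refl
pigeonhole (suc a ∷ f) _ [] ()
pigeonhole f@(suc _ ∷ _) i {x ∷ xs} (cons b hd hc) ≤len with Vec.lookup f b in eq
... | zero  = b , [] , minimum (x ∷ xs) , [] , sym eq
... | suc m with pigeonhole (f [ b ]%= λ _ → m) i hc
                   (s≤s⁻¹ (≤-trans (≤-reflexive (sym (sum-decrement f b eq))) ≤len))
...   | b′ , ys , ys≼ , hcy , len with b Fin.≟ b′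
...     | yes refl = b , x ∷ ys , refl ∷ ys≼ , cons (λ w w≼ → hd w (≼-trans w≼ ys≼)) hcy ,
                     trans (cong suc (trans len (Vec.lookup∘updateAt b f))) (sym eq)
...     | no  b≢b′ = b′ , ys , x ∷ʳ ys≼ , hcy , trans len (Vec.lookup∘updateAt′ b′ b (≢-sym b≢b′) f)

-- Sublists of length `r` stand for `r`-sets. `N` is uniform in `κ`, so the induction may pass to
-- the colourings that put a fixed `x` in front.
Ramsey : (q r s : ℕ) → ℕ → Set₁
Ramsey q r s N = ∀ {A : Set} (κ : List A → Fin q) xs → N ≤ length xs →
                 ∃[ ys ] ys ≼ xs × s ≤ length ys × Homogeneous r κ ys

headColoured : (∀ s → ∃ (Ramsey q r s)) → ∀ s →
               ∃[ N ] ∀ {A : Set} (κ : List A → Fin q) xs → N ≤ length xs →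
                 ∃[ ys ] ys ≼ xs × s ≤ length ys × HeadColoured r κ ys
headColoured ramsey zero = 0 , λ κ xs _ → [] , minimum xs , z≤n , []
headColoured {q} {r} ramsey (suc s) with headColoured {q} {r} ramsey s
-- `N` entries feed the recursive call; `r` entries make `take r ys` have full length, and its
-- colour after `x` becomes the colour of the head `x`.
... | N , hc with ramsey (r + N)
...   | M , hom = suc M , extend
  where
  extend : ∀ {A : Set} (κ : List A → Fin q) xs → suc M ≤ length xs →
           ∃[ ys ] ys ≼ xs × suc s ≤ length ys × HeadColoured r κ ys
  extend κ (x ∷ xs) (s≤s M≤) with hom (λ w → κ (x ∷ w)) xs M≤
  ... | ys , ys≼ , r+N≤ , homY with hc κ ys (≤-trans (ℕ.m≤n+m N r) r+N≤)
  ...   | zs , zs≼ , s≤ , hcz = x ∷ zs , refl ∷ ≼-trans zs≼ ys≼ , s≤s s≤ , cons (κ (x ∷ take r ys)) colour hcz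
    where
    colour : HeadColour r κ (κ (x ∷ take r ys)) x zs
    colour w w≼ len = homY w (take r ys) (≼-trans w≼ zs≼) (take-⊆ r ys) len
      (trans (length-take r ys) (ℕ.m≤n⇒m⊓n≡m (≤-trans (ℕ.m≤m+n r N) r+N≤)))

ramsey : ∀ q r s → ∃ (Ramsey q r s)
ramsey q zero    s = s , λ κ xs s≤ → xs , ≼-refl , s≤ , λ { [] [] _ _ _ _ → refl }
ramsey q (suc r) s with headColoured (ramsey q r) (Vec.sum (Vec.replicate q s))
... | N , hc = N , homogeneous
  where
  homogeneous : Ramsey q (suc r) s N
  homogeneous κ xs N≤ with hc κ xs N≤
  -- Every colour has demand `s`, so some colour has `s` heads. `κ []` serves as an inhabitant of
  -- `Fin q`.
  ... | ys , ys≼ , ≤len , hcy with pigeonhole (Vec.replicate q s) (κ []) hcy ≤len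
  ...   | b , zs , zs≼ , const , len =
    zs , ≼-trans zs≼ ys≼ , ≤-reflexive (sym (trans len (Vec.lookup-replicate b s))) ,
    λ v w v≼ w≼ ∣v∣ ∣w∣ → trans (HeadConstant⇒colour const v v≼ ∣v∣) (sym (HeadConstant⇒colour const w w≼ ∣w∣))

-- The colourings are made homogeneous one after another, since passing to a sublist preserves
-- homogeneity. In the application `is` lists all words of length `r`, each of which colours lists
-- of columns.
simultaneousRamsey : ∀ {W : Set} q r s (is : List W) →
                     ∃[ N ] ∀ {A : Set} (κ : W → List A → Fin q) xs → N ≤ length xs →
                       ∃[ ys ] ys ≼ xs × s ≤ length ys × (∀ {i} → i ∈ˡ is → Homogeneous r (κ i) ys)
simultaneousRamsey q r s [] = s , λ κ xs s≤ → xs , ≼-refl , s≤ , λ ()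
simultaneousRamsey {W} q r s (i ∷ is) with simultaneousRamsey q r s is
... | N , homs with ramsey q r N
...   | M , hom = M , both
  where
  both : ∀ {A : Set} (κ : W → List A → Fin q) xs → M ≤ length xs →
         ∃[ ys ] ys ≼ xs × s ≤ length ys × (∀ {j} → j ∈ˡ i ∷ is → Homogeneous r (κ j) ys)
  both κ xs M≤ with hom (κ i) xs M≤
  ... | ys , ys≼ , N≤ , homY with homs κ ys N≤
  ...   | zs , zs≼ , s≤ , homZ =
    zs , ≼-trans zs≼ ys≼ , s≤ , λ { (here refl) → Homogeneous-≼ zs≼ homY ; (there j∈) → homZ j∈ }

words : ∀ n (r : ℕ) → List (List (Fin n))
words n zero    = [] ∷ []
words n (suc r) = cartesianProductWith _∷_ (allFin n) (words n r)

∈-words : ∀ (w : List (Fin n)) → w ∈ˡ words n (length w)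
∈-words []      = here refl
∈-words (x ∷ w) = ∈-cartesianProductWith⁺ _∷_ (∈-allFin x) (∈-words w)

-- Colourings of hypergraphs

-- Reading the colours in the order of `Fin m` makes every subword of `word f p` come from a subset
-- of `p`, as `sublist-word` shows.
word : (Fin m → B) → Subset m → List B
word f []            = []
word f (outside ∷ p) = word (f ∘ suc) p
word f (inside  ∷ p) = f zero ∷ word (f ∘ suc) p

length-word : ∀ (f : Fin m → B) p → length (word f p) ≡ ∣ p ∣
length-word f []            = refl
length-word f (outside ∷ p) = length-word (f ∘ suc) p
length-word f (inside  ∷ p) = cong suc (length-word (f ∘ suc) p)

∈-word : ∀ (f : Fin m → B) {x p} → x ∈ p → f x ∈ˡ word f p
∈-word f {p = inside  ∷ p} here        = here refl
∈-word f {p = inside  ∷ p} (there x∈p) = there (∈-word (f ∘ suc) x∈p)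
∈-word f {p = outside ∷ p} (there x∈p) = ∈-word (f ∘ suc) x∈p

Unique-≼ : ∀ {xs ys : List A} → xs ≼ ys → Unique ys → Unique xs
Unique-≼ []           []       = []
Unique-≼ (_ ∷ʳ xs≼)   (_ ∷ u)  = Unique-≼ xs≼ u
Unique-≼ (refl ∷ xs≼) (x∉ ∷ u) = All-resp-⊆ xs≼ x∉ ∷ Unique-≼ xs≼ u

sublist-word : ∀ (f : Fin m → B) p {w} → w ≼ word f p → ∃[ s ] s ⊆ p × word f s ≡ w
sublist-word f []            []          = [] , id , refl
sublist-word f (outside ∷ p) w≼ with s , s⊆p , eq ← sublist-word (f ∘ suc) p w≼ =
  outside ∷ s , out⊆ s⊆p , eq
sublist-word f (inside ∷ p) (_ ∷ʳ w≼) with s , s⊆p , eq ← sublist-word (f ∘ suc) p w≼ =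
  outside ∷ s , out⊆ s⊆p , eq
sublist-word f (inside ∷ p) (refl ∷ w≼) with s , s⊆p , eq ← sublist-word (f ∘ suc) p w≼ =
  inside ∷ s , in⊆in s⊆p , cong (f zero ∷_) eq

All-word : ∀ {P : B → Set} (f : Fin m → B) p → (∀ {x} → x ∈ p → P (f x)) → All P (word f p)
All-word f []            Pf = []
All-word f (outside ∷ p) Pf = All-word (f ∘ suc) p (Pf ∘ there)
All-word f (inside  ∷ p) Pf = Pf here ∷ All-word (f ∘ suc) p (Pf ∘ there)

Unique-word : ∀ (f : Fin m → B) p → (∀ {x y} → x ∈ p → y ∈ p → f x ≡ f y → x ≡ y) → Unique (word f p)
Unique-word f []            inj = []
Unique-word f (outside ∷ p) inj =
  Unique-word (f ∘ suc) p λ x∈ y∈ eq → Fin.suc-injective (inj (there x∈) (there y∈) eq)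
Unique-word f (inside  ∷ p) inj =
  All-word (f ∘ suc) p (λ x∈ eq → Fin.0≢1+n (inj here (there x∈) eq)) ∷
  Unique-word (f ∘ suc) p λ x∈ y∈ eq → Fin.suc-injective (inj (there x∈) (there y∈) eq)

-- With `p` a pair of vertices of different colours, this shrinks an edge to `r + 1` vertices while
-- its word stays non-constant; with `p` empty, it yields `r`-subsets.
between : ∀ {p e : Subset m} {t} → p ⊆ e → ∣ p ∣ ≤ t → t ≤ ∣ e ∣ → ∃[ s ] p ⊆ s × s ⊆ e × ∣ s ∣ ≡ t
between {p = []} {[]} {zero} _ _ _ = [] , id , id , refl
between {p = outside ∷ p} {outside ∷ e} p⊆e ∣p∣≤t t≤∣e∣
  with s , p⊆s , s⊆e , eq ← between (drop-∷-⊆ p⊆e) ∣p∣≤t t≤∣e∣ =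
  outside ∷ s , out⊆ p⊆s , out⊆ s⊆e , eq
between {p = outside ∷ p} {inside ∷ e} {t} p⊆e ∣p∣≤t t≤1+∣e∣ with t ℕ.≤? ∣ e ∣
... | yes t≤∣e∣ with s , p⊆s , s⊆e , eq ← between (λ x∈p → drop-there (p⊆e (there x∈p))) ∣p∣≤t t≤∣e∣ =
  outside ∷ s , out⊆ p⊆s , out⊆ s⊆e , eq
-- Here `t` is one more than the size of the rest of the edge, so the whole edge is taken.
... | no  t≰∣e∣ = inside ∷ e , p⊆e , id , ℕ.≤-antisym (ℕ.≰⇒> t≰∣e∣) t≤1+∣e∣
between {p = inside ∷ p} {outside ∷ e} p⊆e _ _ = contradiction (p⊆e here) λ ()
between {p = inside ∷ p} {inside ∷ e} {suc t} p⊆e (s≤s ∣p∣≤t) (s≤s t≤∣e∣)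
  with s , p⊆s , s⊆e , eq ← between (drop-∷-⊆ p⊆e) ∣p∣≤t t≤∣e∣ =
  inside ∷ s , in⊆in p⊆s , in⊆in s⊆e , cong suc eq

r-subset : (e : Subset m) → r ≤ ∣ e ∣ → ∃[ s ] s ⊆ e × ∣ s ∣ ≡ r
r-subset {m} e r≤ with s , _ , s⊆e , eq ← between (⊆-min e) (≤-trans (≤-reflexive (∣⊥∣≡0 m)) z≤n) r≤ =
  s , s⊆e , eq

some-r-subset : r ≤ m → r -SubsetOf m
some-r-subset {m = m} r≤m with s , _ , ∣s∣ ← r-subset ⊤ (≤-trans r≤m (≤-reflexive (sym (∣⊤∣≡n m)))) = s , ∣s∣

pair-⊆ : ∀ {x y} {e : Subset m} → x ∈ e → y ∈ e → support (x ∷ y ∷ []) ⊆ e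
pair-⊆ {x = x} {y} x∈e y∈e z∈ with ∈-support⁻ (x ∷ y ∷ []) z∈
... | here refl         = x∈e
... | there (here refl) = y∈e

-- An edge has two vertices of different colours, and `1≤r` leaves room for both in a subset of
-- `r + 1` vertices. The word of that subset is non-constant, but would be homogeneous if the edge
-- were monochromatic.
wordColourable⇒setColourable : ∀ H → 1 ≤ r → VertexColourable H n → WordColourable n r k → SetColourable H r k
wordColourable⇒setColourable {r} H 1≤r (f , f-proper) (d , d-proper) =
  (λ (s , _) → d (word f s)) , λ e e∈H r<∣e∣ mono →
    f-proper e e∈H λ x y x∈e y∈e → decidable-stable (f x Fin.≟ f y) (λ fx≢fy →
      two-colours e r<∣e∣ mono x∈e y∈e fx≢fy)
  where
  two-colours : ∀ e → suc r ≤ ∣ e ∣ → Monochromatic {r = r} (λ (s , _) → d (word f s)) e →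
                ∀ {x y} → x ∈ e → y ∈ e → ¬ (f x ≢ f y)
  two-colours e r<∣e∣ mono {x} {y} x∈e y∈e fx≢fy
    with t , xy⊆t , t⊆e , ∣t∣ ← between (pair-⊆ x∈e y∈e)
           (≤-trans (∣support∣≤length (x ∷ y ∷ [])) (s≤s 1≤r)) r<∣e∣
    = d-proper (word f t) (trans (length-word f t) ∣t∣)
        (∈-word f (xy⊆t (∈-support⁺ {w = x ∷ y ∷ []} (here refl))))
        (∈-word f (xy⊆t (∈-support⁺ {w = x ∷ y ∷ []} (there (here refl)))))
        fx≢fy hom
    where
    hom : Homogeneous r d (word f t)
    hom v w v≼ w≼ ∣v∣ ∣w∣ with sublist-word f t v≼ | sublist-word f t w≼
    ... | s , s⊆t , refl | s′ , s′⊆t , refl =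
      mono (s  , trans (sym (length-word f s)) ∣v∣) (s′ , trans (sym (length-word f s′)) ∣w∣)
           (⊆-trans s⊆t t⊆e) (⊆-trans s′⊆t t⊆e)

-- The vertices form `r` rows of length `n`, coloured by column. A colour class meets each row once,
-- so its `r` vertices are too few for an edge.
completeUniform-vertexColourable : ∀ n r {2≤} → VertexColourable (completeUniform (r * n) (suc r) 2≤) n
completeUniform-vertexColourable n r = remainder {r} n , λ e ∣e∣≡1+r same → ℕ.<-irrefl refl (begin-strict
  r                                   <⟨ ≤-reflexive (sym ∣e∣≡1+r) ⟩
  ∣ e ∣                               ≡⟨ length-word (quotient {r} n) e ⟨
  length (word (quotient {r} n) e)    ≡⟨ Unique⇒∣support∣≡length (Unique-word (quotient {r} n) e (injective same)) ⟨
  ∣ support (word (quotient {r} n) e) ∣ ≤⟨ ∣p∣≤n (support (word (quotient {r} n) e)) ⟩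
  r                                   ∎)
  where
  open ℕ.≤-Reasoning
  injective : ∀ {e : Subset (r * n)} →
              (∀ x y → x ∈ e → y ∈ e → remainder {r} n x ≡ remainder {r} n y) →
              ∀ {x y} → x ∈ e → y ∈ e → quotient {r} n x ≡ quotient {r} n y → x ≡ y
  injective same {x} {y} x∈e y∈e eq =
    trans (sym (combine-remQuot {r} n x)) (trans (cong₂ combine eq (same x y x∈e y∈e)) (combine-remQuot {r} n y))

x∉p∩∁⁅x⁆ : ∀ (x : Fin m) p → x ∉ p ∩ ∁ ⁅ x ⁆
x∉p∩∁⁅x⁆ x p x∈ = x∈∁p⇒x∉p (proj₂ (x∈p∩q⁻ p (∁ ⁅ x ⁆) x∈)) (x∈⁅x⁆ x)

∣p∣≤1+∣p∩∁⁅x⁆∣ : ∀ (x : Fin m) p → ∣ p ∣ ≤ suc ∣ p ∩ ∁ ⁅ x ⁆ ∣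
∣p∣≤1+∣p∩∁⁅x⁆∣ x p = ≤-trans (p⊆q⇒∣p∣≤∣q∣ p⊆)
  (≤-reflexive (x∉p⇒∣⁅x⁆∪p∣≡1+∣p∣ x (p ∩ ∁ ⁅ x ⁆) (x∉p∩∁⁅x⁆ x p)))
  where
  p⊆ : p ⊆ ⁅ x ⁆ ∪ (p ∩ ∁ ⁅ x ⁆)
  p⊆ {y} y∈p with y ∈? ⁅ x ⁆
  ... | yes y∈x = p⊆p∪q _ y∈x
  ... | no  y∉x = q⊆p∪q ⁅ x ⁆ _ (x∈p∩q⁺ (y∈p , x∉p⇒x∈∁p y∉x))

-- Each set is coloured by one of its own elements. If all `r`-subsets of `e` had colour `x`, then
-- so would one that avoids `x`. The bound is the starting point for the search for a least number
-- of colours.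
setColourable-order : ∀ H → 1 ≤ r → SetColourable H r (order H)
setColourable-order {suc r} H _ =
  proj₁ ∘ pick , λ e _ r<∣e∣ mono → missed e r<∣e∣ mono
  where
  pick : (s : suc r -SubsetOf order H) → ∃ (_∈ proj₁ s)
  pick (s , ∣s∣) with nonempty? s
  ... | yes x∈s  = x∈s
  ... | no empty = contradiction
    (trans (sym ∣s∣) (trans (cong ∣_∣ (Empty-unique empty)) (∣⊥∣≡0 (order H)))) λ ()
  missed : ∀ e → suc (suc r) ≤ ∣ e ∣ → ¬ Monochromatic (proj₁ ∘ pick) e
  missed e r<∣e∣ mono
    with s , s⊆e , ∣s∣ ← r-subset e (ℕ.<⇒≤ r<∣e∣)
    with x , x∈s ← pick (s , ∣s∣) in eq
    with t , t⊆ , ∣t∣ ← r-subset (e ∩ ∁ ⁅ x ⁆) (s≤s⁻¹ (≤-trans r<∣e∣ (∣p∣≤1+∣p∩∁⁅x⁆∣ x e)))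
    = x∉p∩∁⁅x⁆ x e (t⊆ (subst (_∈ t)
        (trans (mono (t , ∣t∣) (s , ∣s∣) (p∩q⊆p e _ ∘ t⊆) s⊆e) (cong proj₁ eq))
        (proj₂ (pick (t , ∣t∣)))))

-- Sets of the wrong size get the junk value c s₀.
extend : (r -SubsetOf m → B) → r -SubsetOf m → Subset m → B
extend {r} c s₀ s with ∣ s ∣ ℕ.≟ r
... | yes eq = c (s , eq)
... | no  _  = c s₀

extend-≡ : ∀ (c : r -SubsetOf m → B) s₀ s → extend c s₀ (proj₁ s) ≡ c s
extend-≡ {r} c s₀ (s , eq) with ∣ s ∣ ℕ.≟ r
... | yes eq′ = cong (λ e → c (s , e)) (ℕ.≡-irrelevant eq′ eq)
... | no  neq = contradiction eq neq

-- Exhaustive search for colourings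

Searchable : Set → Set₁
Searchable A = ∀ {P : A → Set} → Decidable P → Dec (∃ P)

glue : (Subset m → A) → (Subset m → A) → Subset (suc m) → A
glue f g (outside ∷ p) = f p
glue f g (inside  ∷ p) = g p

-- The first coordinate splits a colouring into two colourings of the subsets of a smaller set, down
-- to a single value. The parts recover the colouring only pointwise, hence the hypothesis that `P`
-- respects pointwise equality.
searchColouring : Searchable A → ∀ m {P : (Subset m → A) → Set} →
                  (∀ {f g} → (∀ s → f s ≡ g s) → P f → P g) → Decidable P → Dec (∃ P)
searchColouring search zero resp P? =
  map′ (λ (a , Pa) → _ , Pa) (λ (f , Pf) → f [] , resp (λ { [] → refl }) Pf)
       (search (λ a → P? (λ _ → a)))
searchColouring search (suc m) resp P? =
  map′ (λ (_ , _ , P) → _ , P)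
       (λ (f , Pf) → f ∘ (outside ∷_) , f ∘ (inside ∷_) ,
          resp (λ { (outside ∷ _) → refl ; (inside ∷ _) → refl }) Pf)
       (searchColouring search m
          (λ f≗f′ (g , P) → g , resp (λ { (outside ∷ s) → f≗f′ s ; (inside ∷ _) → refl }) P)
          λ f → searchColouring search m
            (λ g≗g′ → resp (λ { (outside ∷ _) → refl ; (inside ∷ s) → g≗g′ s }))
            (λ g → P? (glue f g)))

allSubset? : ∀ {P : Subset m → Set} → Decidable P → Dec (∀ s → P s)
allSubset? P? = map′ (λ none s → decidable-stable (P? s) (λ ¬Ps → none (s , ¬Ps)))
                     (λ all (s , ¬Ps) → ¬Ps (all s))
                     (¬? (anySubset? (¬? ∘ P?)))

monochromatic? : ∀ (c : Subset m → Fin k) r (e : Subset m) → Dec (Monochromatic {r = r} (c ∘ proj₁) e)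
monochromatic? c r e = map′
  (λ mono (s , ∣s∣) (t , ∣t∣) → mono s t ∣s∣ ∣t∣) (λ mono s t ∣s∣ ∣t∣ → mono (s , ∣s∣) (t , ∣t∣))
  (allSubset? λ s → allSubset? λ t → (∣ s ∣ ℕ.≟ r) →-dec (∣ t ∣ ℕ.≟ r) →-dec
     ((s ⊆? e) →-dec ((t ⊆? e) →-dec (c s Fin.≟ c t))))


-- The search runs over colourings of all subsets; restriction and `extend` translate between these
-- and colourings of `r`-sets.
setColourable? : ∀ H → Decidable (Edge H) → ∀ r → Decidable (SetColourable H r)
setColourable? H edge? r k with r ℕ.≤? order H
-- There are no `r`-sets and no edges of size above `r`, so the empty colouring works for every `k`,
-- including zero.
... | no r≰m = yes
  ( (λ (s , ∣s∣) → contradiction (≤-trans (≤-reflexive (sym ∣s∣)) (∣p∣≤n s)) r≰m)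
  , λ e _ r<∣e∣ _ → contradiction (≤-trans (ℕ.<⇒≤ r<∣e∣) (∣p∣≤n e)) r≰m )
... | yes r≤m = map′ restricted extended
  (searchColouring (λ P? → Fin.any? P?) (order H) Proper-resp
    λ c → allSubset? λ e → edge? e →-dec ((suc r ℕ.≤? ∣ e ∣) →-dec ¬? (monochromatic? c r e)))
  where
  Proper : (Subset (order H) → Fin k) → Set
  Proper c = ∀ e → Edge H e → suc r ≤ ∣ e ∣ → ¬ Monochromatic {r = r} (c ∘ proj₁) e
  Proper-resp : ∀ {c d} → (∀ s → c s ≡ d s) → Proper c → Proper d
  Proper-resp c≗d proper e e∈H r<∣e∣ mono = proper e e∈H r<∣e∣ λ s t s⊆e t⊆e →
    trans (c≗d _) (trans (mono s t s⊆e t⊆e) (sym (c≗d _)))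
  restricted : ∃ Proper → SetColourable H r k
  restricted (c , proper) = c ∘ proj₁ , proper
  s₀ : r -SubsetOf order H
  s₀ = some-r-subset r≤m
  extended : SetColourable H r k → ∃ Proper
  extended (c , proper) = extend c s₀ , λ e e∈H r<∣e∣ mono → proper e e∈H r<∣e∣ λ s t s⊆e t⊆e →
    trans (sym (extend-≡ c s₀ s)) (trans (mono s t s⊆e t⊆e) (extend-≡ c s₀ t))

least : ∀ {P : ℕ → Set} → Decidable P → ∀ {k} → P k → ∃ (IsLeast P)
least {P} P? {k} = descend (<-wellFounded k)
  where
  descend : ∀ {k} → Acc _<_ k → P k → ∃ (IsLeast P)
  descend {k} (acc smaller) Pk with ℕ.anyUpTo? P? k
  ... | yes (j , j<k , Pj) = descend (smaller j<k) Pj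
  ... | no  none           = k , Pk , λ j Pj → ℕ.≮⇒≥ λ j<k → none (j , j<k , Pj)

-- The extremal case: every hypergraph on Fin m properly coloured by f is a subhypergraph of this one.
nonConstant : (Fin m → Fin n) → Hypergraph
nonConstant {m} f = record
  { order  = m
  ; Edge   = λ e → ¬ (∀ x y → x ∈ e → y ∈ e → f x ≡ f y)
  ; edge≥2 = λ {e} e∈H → decidable-stable (2 ℕ.≤? ∣ e ∣) λ ≱2 → e∈H λ x y x∈e y∈e →
      cong f (decidable-stable (x Fin.≟ y) λ x≢y → ≱2 (begin
        2                          ≡⟨ Unique⇒∣support∣≡length {w = x ∷ y ∷ []} ((x≢y ∷ []) ∷ [] ∷ []) ⟨
        ∣ support (x ∷ y ∷ []) ∣   ≤⟨ p⊆q⇒∣p∣≤∣q∣ (pair-⊆ x∈e y∈e) ⟩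
        ∣ e ∣                      ∎))
  }
  where open ℕ.≤-Reasoning

nonConstant? : ∀ (f : Fin m → Fin n) → Decidable (Edge (nonConstant f))
nonConstant? f e = ¬? (Fin.all? λ x → Fin.all? λ y → (x ∈? e) →-dec ((y ∈? e) →-dec (f x Fin.≟ f y)))

nonConstant-vertexColourable : ∀ (f : Fin m → Fin n) → VertexColourable (nonConstant f) n
nonConstant-vertexColourable f = f , λ _ e∈H → e∈H

-- `g` picks a vertex of each class. With fewer than `n` colours, two of these representatives
-- agree, and together they form a monochromatic edge.
nonConstant-chromaticNumber : ∀ (f : Fin m → Fin n) (g : Fin n → Fin m) → (∀ i → f (g i) ≡ i) →
                              IsChromaticNumber (nonConstant f) n
nonConstant-chromaticNumber {m} {n} f g fg≡id = nonConstant-vertexColourable f , minimal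
  where
  minimal : ∀ j → VertexColourable (nonConstant f) j → n ≤ j
  minimal j (h , proper) = ℕ.≮⇒≥ λ j<n → clash (Fin.pigeonhole j<n (h ∘ g))
    where
    clash : ¬ (∃₂ λ i i′ → i <ᶠ i′ × h (g i) ≡ h (g i′))
    clash (i , i′ , i<i′ , eq) = proper (support pair)
      (λ same → Fin.<⇒≢ i<i′ (trans (sym (fg≡id i)) (trans (same (g i) (g i′)
         (∈-support⁺ {w = pair} (here refl)) (∈-support⁺ {w = pair} (there (here refl)))) (fg≡id i′))))
      λ x y x∈ y∈ → trans (colour (∈-support⁻ pair x∈)) (sym (colour (∈-support⁻ pair y∈)))
      where
      pair = g i ∷ g i′ ∷ []
      colour : ∀ {x} → x ∈ˡ pair → h x ≡ h (g i)
      colour (here refl)         = refl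
      colour (there (here refl)) = sym eq

-- From set colourings back to word colourings

sublist-zipWith : ∀ {C : Set} (f : A → B → C) xs ys {v} → v ≼ zipWith f xs ys →
                  ∃₂ λ w ℓ → w ≼ xs × ℓ ≼ ys × v ≡ zipWith f w ℓ ×
                             length w ≡ length v × length ℓ ≡ length v
sublist-zipWith f []       ys       [] = [] , [] , [] , minimum ys , refl , refl , refl
sublist-zipWith f (x ∷ xs) []       [] = [] , [] , minimum (x ∷ xs) , [] , refl , refl , refl
sublist-zipWith f (x ∷ xs) (y ∷ ys) (_ ∷ʳ v≼)
  with w , ℓ , w≼ , ℓ≼ , eq , ∣w∣ , ∣ℓ∣ ← sublist-zipWith f xs ys v≼ =
  w , ℓ , x ∷ʳ w≼ , y ∷ʳ ℓ≼ , eq , ∣w∣ , ∣ℓ∣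
sublist-zipWith f (x ∷ xs) (y ∷ ys) (refl ∷ v≼)
  with w , ℓ , w≼ , ℓ≼ , eq , ∣w∣ , ∣ℓ∣ ← sublist-zipWith f xs ys v≼ =
  x ∷ w , y ∷ ℓ , refl ∷ w≼ , refl ∷ ℓ≼ , cong (f x y ∷_) eq , cong suc ∣w∣ , cong suc ∣ℓ∣

map-quotient : ∀ (xs : List (Fin n)) (ys : List (Fin m)) → length xs ≡ length ys →
               map (quotient m) (zipWith combine xs ys) ≡ xs
map-quotient []       []       _  = refl
map-quotient (x ∷ xs) (y ∷ ys) eq =
  cong₂ _∷_ (cong proj₁ (remQuot-combine x y)) (map-quotient xs ys (ℕ.suc-injective eq))

map-remainder : ∀ (xs : List (Fin n)) (ys : List (Fin m)) → length xs ≡ length ys →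
                map (remainder {n} m) (zipWith combine xs ys) ≡ ys
map-remainder []       []       _  = refl
map-remainder (x ∷ xs) (y ∷ ys) eq =
  cong₂ _∷_ (cong proj₂ (remQuot-combine x y)) (map-remainder xs ys (ℕ.suc-injective eq))

length-take-≤ : ∀ (xs : List A) → n ≤ length xs → length (take n xs) ≡ n
length-take-≤ {n = n} xs n≤ = trans (length-take n xs) (ℕ.m≤n⇒m⊓n≡m n≤)

module _ (c : r -SubsetOf (n * m) → Fin k) (s₀ : r -SubsetOf (n * m)) where

  -- The vertices form an n × m grid with colour classes the rows; the letters of w choose rows, ℓ columns.
  placedColour : List (Fin n) → List (Fin m) → Fin k
  placedColour w ℓ = extend c s₀ (support (zipWith combine w ℓ))

  -- By homogeneity on `ℓ`, the colour of the set with rows `w` does not depend on the columns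
  -- chosen from `ℓ`. A bad word `t`, placed on the first `r + 1` columns of `ℓ`, would therefore
  -- give a monochromatic set, which is an edge because `t` is not constant.
  placedColour-proper : (∀ e → Edge (nonConstant (quotient {n} m)) e → suc r ≤ ∣ e ∣ → ¬ Monochromatic c e) →
                        ∀ ℓ → Unique ℓ → suc r ≤ length ℓ →
                        (∀ w → length w ≡ r → Homogeneous r (placedColour w) ℓ) →
                        ∀ t {x y} → length t ≡ suc r → x ∈ˡ t → y ∈ˡ t → x ≢ y →
                        ¬ Homogeneous r (λ w → placedColour w (take r ℓ)) t
  placedColour-proper proper ℓ unique r<∣ℓ∣ homℓ t {x} {y} ∣t∣ x∈t y∈t x≢y homt =
    proper (support v)
      (λ same → x≢y (trans (sym (proj₂ (proj₂ (vertex x∈t)))) (trans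
         (same _ _ (proj₁ (proj₂ (vertex x∈t))) (proj₁ (proj₂ (vertex y∈t))))
         (proj₂ (proj₂ (vertex y∈t))))))
      (≤-reflexive (sym ∣support-v∣))
      λ s s′ s⊆ s′⊆ →
        let w  , w≼  , ∣w∣  , eq  = colourOf s  s⊆
            w′ , w′≼ , ∣w′∣ , eq′ = colourOf s′ s′⊆
        in trans eq (trans (homt w w′ w≼ w′≼ ∣w∣ ∣w′∣) (sym eq′))
    where
    ℓ′ = take (suc r) ℓ
    v  = zipWith combine t ℓ′
    ∣t∣≡∣ℓ′∣ : length t ≡ length ℓ′
    ∣t∣≡∣ℓ′∣ = trans ∣t∣ (sym (length-take-≤ ℓ r<∣ℓ∣))
    -- `t` may repeat letters; the vertices are distinct because their columns are.
    unique-v : Unique v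
    unique-v = Unique.map⁻ (subst Unique (sym (map-remainder t ℓ′ ∣t∣≡∣ℓ′∣)) (Unique.take⁺ (suc r) unique))
    ∣support-v∣ : ∣ support v ∣ ≡ suc r
    ∣support-v∣ = begin
      ∣ support v ∣               ≡⟨ Unique⇒∣support∣≡length unique-v ⟩
      length v                        ≡⟨ length-map (quotient {n} m) v ⟨
      length (map (quotient {n} m) v) ≡⟨ cong length (map-quotient t ℓ′ ∣t∣≡∣ℓ′∣) ⟩
      length t                    ≡⟨ ∣t∣ ⟩
      suc r                       ∎
      where open ≡-Reasoning
    vertex : ∀ {z} → z ∈ˡ t → ∃[ u ] u ∈ support v × quotient m u ≡ z
    vertex z∈t with u , u∈v , eq ← ∈-map⁻ (quotient m) (subst (_ ∈ˡ_) (sym (map-quotient t ℓ′ ∣t∣≡∣ℓ′∣)) z∈t) =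
      u , ∈-support⁺ u∈v , sym eq
    colourOf : ∀ s → proj₁ s ⊆ support v →
               ∃[ w ] w ≼ t × length w ≡ r × c s ≡ placedColour w (take r ℓ)
    colourOf s s⊆
      with v′ , v′≼ , eq , ∣v′∣ ← sublist-with-support unique-v (proj₁ s) s⊆
      with w , j , w≼ , j≼ , refl , ∣w∣ , ∣j∣ ← sublist-zipWith combine t ℓ′ v′≼
      = w , w≼ , ∣w∣≡r , (begin
          c s                             ≡⟨ extend-≡ c s₀ s ⟨
          extend c s₀ (proj₁ s)           ≡⟨ cong (extend c s₀) eq ⟨
          placedColour w j                ≡⟨ homℓ w ∣w∣≡r j (take r ℓ) (≼-trans j≼ (take-⊆ (suc r) ℓ)) (take-⊆ r ℓ)
                                               (trans ∣j∣ (trans ∣v′∣ (proj₂ s))) (length-take-≤ ℓ (ℕ.<⇒≤ r<∣ℓ∣)) ⟩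
          placedColour w (take r ℓ)       ∎)
      where
      open ≡-Reasoning
      ∣w∣≡r = trans ∣w∣ (trans ∣v′∣ (proj₂ s))

-- The bound q on the number of colours makes the choice of m independent of k.
nonConstant⇒wordColourable : ∀ n r q → .{{NonZero n}} →
  ∃[ m ] ∀ {k} → k ≤ q → SetColourable (nonConstant (quotient {n} (suc m))) r k → WordColourable n r k
nonConstant⇒wordColourable n@(suc _) r q with simultaneousRamsey q r (suc r) (words n r)
... | N , hom = r + N , λ {k} k≤q (c , proper) → transfer k≤q c proper
  where
  -- `N` columns serve Ramsey's theorem, `r` ensure that an `r`-set `s₀` exists, and the successor
  -- gives every row a column `zero`.
  M = suc (r + N)
  s₀ : r -SubsetOf (n * M)
  s₀ = some-r-subset (≤-trans (≤-trans (ℕ.m≤m+n r N) (ℕ.n≤1+n _)) (ℕ.m≤n*m M n))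
  transfer : ∀ {k} → k ≤ q → (c : r -SubsetOf (n * M) → Fin k) → _ → WordColourable n r k
  transfer k≤q c proper
    with ℓ , ℓ≼ , r<∣ℓ∣ , homℓ ← hom (λ w j → inject≤ (placedColour c s₀ w j) k≤q) (allFin M)
           (≤-trans (ℕ.m≤n+m N (suc r)) (≤-reflexive (sym (length-tabulate id))))
    = (λ w → placedColour c s₀ w (take r ℓ)) ,
      placedColour-proper c s₀ proper ℓ (Unique-≼ ℓ≼ (Unique.allFin⁺ M)) r<∣ℓ∣
        λ { w refl i j i≼ j≼ ∣i∣ ∣j∣ → inject≤-injective k≤q k≤q _ _ (homℓ (∈-words w) i j i≼ j≼ ∣i∣ ∣j∣) }

-- The maximum is attained by the grid `H`: an optimal colouring of `H` gives a good word colouring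
-- with equally many colours, which in turn bounds every competitor. The bound `q` fixes the size of
-- the grid before `k` is known.
k⟨n,r⟩-exists : ∀ n r q → .{{NonZero n}} → 1 ≤ r → WordColourable n r q →
                ∃[ k ] Is-k⟨ n , r ⟩ k × k ≤ q × WordColourable n r k
k⟨n,r⟩-exists n r q 1≤r col with nonConstant⇒wordColourable n r q
... | m , canonical = finish (least (setColourable? H (nonConstant? f) r) H-colourable)
  where
  f : Fin (n * suc m) → Fin n
  f = quotient (suc m)
  H = nonConstant f
  H-colourable : SetColourable H r q
  H-colourable = wordColourable⇒setColourable H 1≤r (nonConstant-vertexColourable f) col
  χ≡n : IsChromaticNumber H n
  χ≡n = nonConstant-chromaticNumber f (λ i → combine i zero) (λ i → cong proj₁ (remQuot-combine i zero))
  finish : ∃ Is-k[ H ⨾ r ] → ∃[ k ] Is-k⟨ n , r ⟩ k × k ≤ q × WordColourable n r k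
  finish (k , k-colourable , k-least) = k , ((H , χ≡n , k-colourable , k-least) , maximal) , k≤q , k-words
    where
    k≤q : k ≤ q
    k≤q = k-least q H-colourable
    k-words : WordColourable n r k
    k-words = canonical k≤q k-colourable
    maximal : ∀ j → ∃[ G ] (IsChromaticNumber G n × Is-k[ G ⨾ r ] j) → j ≤ k
    maximal j (G , (G-colourable , _) , (_ , j-least)) =
      j-least k (wordColourable⇒setColourable G 1≤r G-colourable k-words)

k-completeUniform-exists : ∀ m {r} 2≤ → 1 ≤ r → ∃ Is-k[ completeUniform m (suc r) 2≤ ⨾ r ]
k-completeUniform-exists m {r} 2≤ 1≤r =
  least (setColourable? K (λ e → ∣ e ∣ ℕ.≟ suc r) r) (setColourable-order K 1≤r)
  where K = completeUniform m (suc r) 2≤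

theorem4p2 : (n r : ℕ) → .{{_ : NonZero n}} → .{{_ : NonZero r}} →
    ∃₂ λ a k →
    Is-k[ completeUniform (r * n) (suc r) (s≤s (>-nonZero⁻¹ r)) ⨾ r ] a ×
    Is-k⟨ n , r ⟩ k ×
    a ≤ k ×
    k ≤ a + 5
theorem4p2 n r
  with a , a-colourable , a-least ← k-completeUniform-exists (r * n) (s≤s (>-nonZero⁻¹ r)) (>-nonZero⁻¹ r)
  -- The bound `a + 4` comes from restricting an optimal colouring on `r * n` vertices to `n`
  -- vertices and adding the four colours for words with repetitions.
  with k , k-max , k≤a+4 , k-words ← k⟨n,r⟩-exists n r (a + 4) (>-nonZero⁻¹ r)
         (setColourable⇒wordColourable {2≤ = s≤s (>-nonZero⁻¹ r)}
           (restrict {2≤ = s≤s (>-nonZero⁻¹ r)} (ℕ.≤⇒≤′ (ℕ.m≤n*m n r)) a-colourable)) =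
  a , k , (a-colourable , a-least) , k-max ,
  a-least k (wordColourable⇒setColourable (completeUniform (r * n) (suc r) (s≤s (>-nonZero⁻¹ r)))
    (>-nonZero⁻¹ r) (completeUniform-vertexColourable n r {s≤s (>-nonZero⁻¹ r)}) k-words) ,
  -- The construction reaches `a + 4`, which is weakened to the stated bound.
  ≤-trans k≤a+4 (ℕ.+-monoʳ-≤ a (ℕ.n≤1+n 4))
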